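{- Let $\mathbf{x}=(x_1,\dots,x_5)$ and $\mathbf{y}=(y_1,\dots,y_4)$ be real variables, and let $P$ be the $5\times 4$ biquadratic form \[ \begin{aligned} P(\mathbf{x},\mathbf{y}) =&\; x_1^2 y_1^2 + x_1^2 y_2^2 + x_1^2 y_3^2 + x_2^2 y_1^2 + x_2^2 y_4^2 + x_3^2 y_2^2 + x_3^2 y_4^2 \\ &+ x_4^2 y_3^2 + x_4^2 y_4^2 + x_5^2 y_1^2 + (x_2 y_3 + x_5 y_4)^2 + (x_4 + x_5)^2 y_2^2 . \end{aligned} \] Then $\operatorname{sos}(P)=12$.
   Context: An $m\times n$ biquadratic form is a polynomial $P(\mathbf{x},\mathbf{y})=\sum_{i=1}^m\sum_{j=1}^n\sum_{k=1}^m\sum_{l=1}^n a_{ijkl}\,x_i x_k y_j y_l$ with real coefficients, where $\mathbf{x}=(x_1,\dots,x_m)$ and $\mathbf{y}=(y_1,\dots,y_n)$. A bilinear form is a polynomial $\ell(\mathbf{x},\mathbf{y})=\sum_{i=1}^m\sum_{j=1}^n a_{ij}x_i y_j$ with real coefficients. For a biquadratic form $P$ that is a sum of squares of bilinear forms, the SOS rank $\operatorname{sos}(P)$ is the minimal number $r$ such that $P=\sum_{k=1}^r \ell_k(\mathbf{x},\mathbf{y})^2$ for some bilinear forms $\ell_1,\dots,\ell_r$. -}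

module Defs where

open import Algebra.Apartness.Structures using (IsHeytingField)
open import Algebra.Bundles using (CommutativeRing; Semiring)
open import Data.Fin.Base using (Fin; zero; suc)
open import Data.Fin.Patterns using (0F; 1F; 2F; 3F; 4F)
open import Data.Nat.Base as ℕ using (ℕ)
open import Data.Product.Base using (∃; ∃-syntax; _×_; _,_)
open import Data.Sum.Base using (_⊎_; inj₁; inj₂)
import Level
open import Level using (_⊔_)
open import Relation.Binary.Core using (Rel)
open import Relation.Binary.Structures using (IsStrictPartialOrder)

record OrderedField c ℓ₁ ℓ₂ : Set (Level.suc (c ⊔ ℓ₁ ⊔ ℓ₂)) where
  infix  8 -_
  infixl 7 _*_
  infixl 6 _+_
  infix  4 _≈_ _<_ _#_
  field
    Carrier : Set c
    _≈_     : Rel Carrier ℓ₁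
    _<_     : Rel Carrier ℓ₂
    _+_     : Carrier → Carrier → Carrier
    _*_     : Carrier → Carrier → Carrier
    -_      : Carrier → Carrier
    0#      : Carrier
    1#      : Carrier

  _#_ : Rel Carrier ℓ₂
  x # y = x < y ⊎ y < x

  field
    isHeytingField       : IsHeytingField _≈_ _#_ _+_ _*_ -_ 0# 1#
    isStrictPartialOrder : IsStrictPartialOrder _≈_ _<_
    +-monoˡ-<            : ∀ {x y} z → x < y → x + z < y + z
    *-positive           : ∀ {x y} → 0# < x → 0# < y → 0# < x * y

  commutativeRing : CommutativeRing c ℓ₁
  commutativeRing = record
    { isCommutativeRing = IsHeytingField.isCommutativeRing isHeytingField }

  open CommutativeRing commutativeRing using (_-_; +-rawMonoid)
  open import Algebra.Definitions.RawMonoid +-rawMonoid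
    using () renaming (_×_ to _·_)

  Archimedean : Set (c ⊔ ℓ₂)
  Archimedean = ∀ x → ∃[ n ] x < n · 1#

  -- Swapping i and j bounds the distance of s i and s j from both sides.
  Cauchy : (ℕ → Carrier) → Set (c ⊔ ℓ₂)
  Cauchy s = ∀ ε → 0# < ε →
    ∃[ N ] ∀ i j → N ℕ.≤ i → N ℕ.≤ j → s i - s j < ε

  _ConvergesTo_ : (ℕ → Carrier) → Carrier → Set (c ⊔ ℓ₂)
  s ConvergesTo x = ∀ ε → 0# < ε →
    ∃[ N ] ∀ i → N ℕ.≤ i → (s i - x < ε) × (x - s i < ε)

  CauchyComplete : Set (c ⊔ ℓ₂)
  CauchyComplete = ∀ s → Cauchy s → ∃[ x ] s ConvergesTo x

-- Classically these axioms determine ℝ up to unique isomorphism.  Order and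
-- apartness are not assumed decidable, so that constructive (Bishop) reals
-- satisfy them as well.
record RealNumbers c ℓ₁ ℓ₂ : Set (Level.suc (c ⊔ ℓ₁ ⊔ ℓ₂)) where
  field
    orderedField : OrderedField c ℓ₁ ℓ₂

  open OrderedField orderedField public

  field
    archimedean    : Archimedean
    cauchyComplete : CauchyComplete

-- The polynomial ring R[V], as the free commutative R-algebra on V: terms
-- modulo the congruence generated by the commutative ring laws and the
-- requirement that con be a ring homomorphism.
module Polynomials {c ℓ} (R : CommutativeRing c ℓ) (V : Set) where

  private module R = CommutativeRing R

  infix  8 -_
  infixl 7 _*_
  infixl 6 _+_
  infix  4 _≋_

  data Polynomial : Set c where
    con : R.Carrier → Polynomial
    var : V → Polynomial
    _+_ : Polynomial → Polynomial → Polynomial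
    _*_ : Polynomial → Polynomial → Polynomial
    -_  : Polynomial → Polynomial

  data _≋_ : Rel Polynomial (c ⊔ ℓ) where
    ≋-refl      : ∀ {p} → p ≋ p
    ≋-sym       : ∀ {p q} → p ≋ q → q ≋ p
    ≋-trans     : ∀ {p q r} → p ≋ q → q ≋ r → p ≋ r

    +-cong      : ∀ {p p′ q q′} → p ≋ p′ → q ≋ q′ → p + q ≋ p′ + q′
    *-cong      : ∀ {p p′ q q′} → p ≋ p′ → q ≋ q′ → p * q ≋ p′ * q′
    -‿cong      : ∀ {p p′} → p ≋ p′ → - p ≋ - p′

    con-cong    : ∀ {a b} → a R.≈ b → con a ≋ con b
    con-+       : ∀ a b → con (a R.+ b) ≋ con a + con b
    con-*       : ∀ a b → con (a R.* b) ≋ con a * con b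

    +-assoc     : ∀ p q r → (p + q) + r ≋ p + (q + r)
    +-comm      : ∀ p q → p + q ≋ q + p
    +-identityˡ : ∀ p → con R.0# + p ≋ p
    -‿inverseˡ  : ∀ p → (- p) + p ≋ con R.0#

    *-assoc     : ∀ p q r → (p * q) * r ≋ p * (q * r)
    *-comm      : ∀ p q → p * q ≋ q * p
    *-identityˡ : ∀ p → con R.1# * p ≋ p
    distribˡ    : ∀ p q r → p * (q + r) ≋ (p * q) + (p * r)

  polynomialRing : CommutativeRing c (c ⊔ ℓ)
  polynomialRing = record
    { Carrier = Polynomial ; _≈_ = _≋_
    ; _+_ = _+_ ; _*_ = _*_ ; -_ = -_ ; 0# = con R.0# ; 1# = con R.1#
    ; isCommutativeRing = record
      { isRing = record
        { +-isAbelianGroup = record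
          { isGroup = record
            { isMonoid = record
              { isSemigroup = record
                { isMagma = record
                  { isEquivalence = record
                    { refl = ≋-refl ; sym = ≋-sym ; trans = ≋-trans }
                  ; ∙-cong = +-cong }
                ; assoc = +-assoc }
              ; identity = +-identityˡ
                         , λ p → ≋-trans (+-comm _ _) (+-identityˡ p) }
            ; inverse = -‿inverseˡ
                      , λ p → ≋-trans (+-comm _ _) (-‿inverseˡ p)
            ; ⁻¹-cong = -‿cong }
          ; comm = +-comm }
        ; *-cong = *-cong
        ; *-assoc = *-assoc
        ; *-identity = *-identityˡ
                     , λ p → ≋-trans (*-comm _ _) (*-identityˡ p)
        ; distrib = distribˡ
                  , λ p q r → ≋-trans (*-comm _ _)
                      (≋-trans (distribˡ p q r)
                        (+-cong (*-comm _ _) (*-comm _ _))) }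
      ; *-comm = *-comm } }

-- Forms in the variables x₁, …, xₘ (left summand) and y₁, …, yₙ (right
-- summand) over a commutative ring R.
module Forms {c ℓ} (R : CommutativeRing c ℓ) (m n : ℕ) where

  open CommutativeRing R using (Carrier)
  open Polynomials R (Fin m ⊎ Fin n) public
  open CommutativeRing polynomialRing using (semiring)
  open import Algebra.Properties.Semiring.Sum semiring public
    using (sum-syntax)
  open import Algebra.Definitions.RawSemiring (Semiring.rawSemiring semiring) public
    using (_^_)

  x : Fin m → Polynomial
  x i = var (inj₁ i)

  y : Fin n → Polynomial
  y j = var (inj₂ j)

  IsBilinearForm : Polynomial → Set (c ⊔ ℓ)
  IsBilinearForm p = ∃ λ (a : Fin m → Fin n → Carrier) →
    p ≋ ∑[ i < m ] ∑[ j < n ] (con (a i j) * x i * y j)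

  IsBiquadraticForm : Polynomial → Set (c ⊔ ℓ)
  IsBiquadraticForm p =
    ∃ λ (a : Fin m → Fin n → Fin m → Fin n → Carrier) →
      p ≋ ∑[ i < m ] ∑[ j < n ] ∑[ k < m ] ∑[ l < n ]
            (con (a i j k l) * x i * x k * y j * y l)

  record BiquadraticForm : Set (c ⊔ ℓ) where
    field
      polynomial        : Polynomial
      isBiquadraticForm : IsBiquadraticForm polynomial

  open BiquadraticForm public

  IsSumOfSquares : ℕ → Polynomial → Set (c ⊔ ℓ)
  IsSumOfSquares r p = ∃ λ (f : Fin r → Polynomial) →
    (∀ k → IsBilinearForm (f k)) × p ≋ ∑[ k < r ] (f k ^ 2)

  -- sos(P) = r, as a relation: constructively the minimum need not be
  -- computable from P.
  HasSosRank : BiquadraticForm → ℕ → Set (c ⊔ ℓ)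
  HasSosRank P r = IsSumOfSquares r (polynomial P)
                 × (∀ s → IsSumOfSquares s (polynomial P) → r ℕ.≤ s)

module BiquadraticClosure {c ℓ} (R : CommutativeRing c ℓ) (m n : ℕ) where

  open Forms R m n
  private
    module R = CommutativeRing R
    module P = CommutativeRing polynomialRing
  open import Algebra.Properties.Semiring.Sum P.semiring
    using (sum-cong-≋; ∑-distrib-+)
  open import Algebra.Solver.Ring.NaturalCoefficients.Default
    P.commutativeSemiring using (solve; _:=_; _:+_; _:*_; _:^_)
  open import Relation.Binary.Reasoning.Setoid P.setoid

  δ : ∀ {k} → Fin k → Fin k → R.Carrier
  δ zero    zero    = R.1#
  δ zero    (suc _) = R.0#
  δ (suc _) zero    = R.0#
  δ (suc i) (suc j) = δ i j

  ∑-zero : ∀ k (f : Fin k → Polynomial) → ∑[ j < k ] (con R.0# * f j) ≋ P.0#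
  ∑-zero ℕ.zero    f = ≋-refl
  ∑-zero (ℕ.suc k) f = begin
    P.0# * f zero + ∑[ j < k ] (P.0# * f (suc j))
      ≈⟨ +-cong (P.zeroˡ _) (∑-zero k (λ j → f (suc j))) ⟩
    P.0# + P.0#
      ≈⟨ +-identityˡ _ ⟩
    P.0# ∎

  ∑-δ : ∀ {k} (i : Fin k) (f : Fin k → Polynomial) →
        ∑[ j < k ] (con (δ i j) * f j) ≋ f i
  ∑-δ zero f = ≋-trans
    (+-cong (*-identityˡ _) (∑-zero _ (λ j → f (suc j)))) (P.+-identityʳ _)
  ∑-δ (suc i) f = ≋-trans
    (+-cong (P.zeroˡ _) (∑-δ i (λ j → f (suc j)))) (+-identityˡ _)

  pull : ∀ u v p q r s →
         con (u R.* v) * p * q * r * s ≋ con u * (con v * p * q * r * s)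
  pull u v p q r s = begin
    con (u R.* v) * p * q * r * s
      ≈⟨ *-cong (*-cong (*-cong (*-cong (con-* u v)
           ≋-refl) ≋-refl) ≋-refl) ≋-refl ⟩
    (con u * con v) * p * q * r * s
      ≈⟨ *-cong (*-cong (*-cong (*-assoc _ _ _) ≋-refl) ≋-refl) ≋-refl ⟩
    con u * (con v * p) * q * r * s
      ≈⟨ *-cong (*-cong (*-assoc _ _ _) ≋-refl) ≋-refl ⟩
    con u * (con v * p * q) * r * s
      ≈⟨ *-cong (*-assoc _ _ _) ≋-refl ⟩
    con u * (con v * p * q * r) * s
      ≈⟨ *-assoc _ _ _ ⟩
    con u * (con v * p * q * r * s) ∎

  monomial : ∀ i k j l → IsBiquadraticForm (x i * x k * y j * y l)
  monomial i k j l = a , ≋-sym (begin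
    (∑[ i′ < m ] ∑[ j′ < n ] ∑[ k′ < m ] ∑[ l′ < n ]
       (con (a i′ j′ k′ l′) * x i′ * x k′ * y j′ * y l′))
      ≈⟨ (sum-cong-≋ λ i′ → sum-cong-≋ λ j′ → sum-cong-≋ λ k′ → ≋-trans
           (sum-cong-≋ λ l′ →
             pull (δ l l′) (b i′ j′ k′) (x i′) (x k′) (y j′) (y l′))
           (∑-δ l λ l′ → con (b i′ j′ k′) * x i′ * x k′ * y j′ * y l′)) ⟩
    (∑[ i′ < m ] ∑[ j′ < n ] ∑[ k′ < m ]
       (con (b i′ j′ k′) * x i′ * x k′ * y j′ * y l))
      ≈⟨ (sum-cong-≋ λ i′ → sum-cong-≋ λ j′ → ≋-trans
           (sum-cong-≋ λ k′ →
             pull (δ k k′) (d i′ j′) (x i′) (x k′) (y j′) (y l))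
           (∑-δ k λ k′ → con (d i′ j′) * x i′ * x k′ * y j′ * y l)) ⟩
    (∑[ i′ < m ] ∑[ j′ < n ] (con (d i′ j′) * x i′ * x k * y j′ * y l))
      ≈⟨ (sum-cong-≋ λ i′ → ≋-trans
           (sum-cong-≋ λ j′ →
             pull (δ j j′) (e i′) (x i′) (x k) (y j′) (y l))
           (∑-δ j λ j′ → con (e i′) * x i′ * x k * y j′ * y l)) ⟩
    (∑[ i′ < m ] (con (e i′) * x i′ * x k * y j * y l))
      ≈⟨ ≋-trans
           (sum-cong-≋ λ i′ →
             pull (δ i i′) R.1# (x i′) (x k) (y j) (y l))
           (∑-δ i λ i′ → con R.1# * x i′ * x k * y j * y l) ⟩
    con R.1# * x i * x k * y j * y l
      ≈⟨ *-cong (*-cong (*-cong (*-identityˡ _) ≋-refl) ≋-refl) ≋-refl ⟩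
    x i * x k * y j * y l ∎)
    where
    e : Fin m → R.Carrier
    e i′ = δ i i′ R.* R.1#
    d : Fin m → Fin n → R.Carrier
    d i′ j′ = δ j j′ R.* e i′
    b : Fin m → Fin n → Fin m → R.Carrier
    b i′ j′ k′ = δ k k′ R.* d i′ j′
    a : Fin m → Fin n → Fin m → Fin n → R.Carrier
    a i′ j′ k′ l′ = δ l l′ R.* b i′ j′ k′

  ∑-merge : ∀ {k} {f g h : Fin k → Polynomial} →
            (∀ i → f i + g i ≋ h i) →
            ∑[ i < k ] f i + ∑[ i < k ] g i ≋ ∑[ i < k ] h i
  ∑-merge {f = f} {g} f+g≋h =
    ≋-trans (≋-sym (∑-distrib-+ f g)) (sum-cong-≋ f+g≋h)

  con-collect : ∀ u v p q r s →
    con u * p * q * r * s + con v * p * q * r * s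
      ≋ con (u R.+ v) * p * q * r * s
  con-collect u v p q r s = begin
    con u * p * q * r * s + con v * p * q * r * s
      ≈⟨ P.distribʳ _ _ _ ⟨
    (con u * p * q * r + con v * p * q * r) * s
      ≈⟨ *-cong (P.distribʳ _ _ _) ≋-refl ⟨
    (con u * p * q + con v * p * q) * r * s
      ≈⟨ *-cong (*-cong (P.distribʳ _ _ _) ≋-refl) ≋-refl ⟨
    (con u * p + con v * p) * q * r * s
      ≈⟨ *-cong (*-cong (*-cong (P.distribʳ _ _ _) ≋-refl) ≋-refl) ≋-refl ⟨
    (con u + con v) * p * q * r * s
      ≈⟨ *-cong (*-cong (*-cong (*-cong (con-+ u v)
           ≋-refl) ≋-refl) ≋-refl) ≋-refl ⟨
    con (u R.+ v) * p * q * r * s ∎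

  infixl 6 _⊕_
  _⊕_ : ∀ {p q} → IsBiquadraticForm p → IsBiquadraticForm q →
        IsBiquadraticForm (p + q)
  (a , p≋) ⊕ (b , q≋) =
    (λ i j k l → a i j k l R.+ b i j k l) ,
    ≋-trans (+-cong p≋ q≋)
      (∑-merge λ i → ∑-merge λ j → ∑-merge λ k → ∑-merge λ l →
        con-collect (a i j k l) (b i j k l) (x i) (x k) (y j) (y l))

  resp : ∀ {p q} → p ≋ q → IsBiquadraticForm q → IsBiquadraticForm p
  resp p≋q (a , q≋) = a , ≋-trans p≋q q≋

  square : ∀ i j → IsBiquadraticForm (x i ^ 2 * y j ^ 2)
  square i j = resp
    (solve 2 (λ p q → (p :^ 2) :* (q :^ 2) := p :* p :* q :* q)
      ≋-refl (x i) (y j))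
    (monomial i i j j)

  square-of-sum : ∀ i j k l → IsBiquadraticForm ((x i * y j + x k * y l) ^ 2)
  square-of-sum i j k l = resp
    (solve 4 (λ p q r s → (p :* q :+ r :* s) :^ 2
        := p :* p :* q :* q :+ p :* r :* q :* s
        :+ r :* p :* s :* q :+ r :* r :* s :* s)
      ≋-refl (x i) (y j) (x k) (y l))
    (monomial i i j j ⊕ monomial i k j l ⊕ monomial k i l j ⊕ monomial k k l l)

  sum-squared : ∀ i k j → IsBiquadraticForm ((x i + x k) ^ 2 * y j ^ 2)
  sum-squared i k j = resp
    (solve 3 (λ p q r → ((p :+ q) :^ 2) :* (r :^ 2)
                     := (p :* r :+ q :* r) :^ 2)
      ≋-refl (x i) (x k) (y j))
    (square-of-sum i j k j)

module _ {c ℓ₁ ℓ₂} (ℝ : RealNumbers c ℓ₁ ℓ₂) where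

  open RealNumbers ℝ using (commutativeRing)
  open Forms commutativeRing 5 4
  open BiquadraticClosure commutativeRing 5 4

  private
    x₁ = x 0F
    x₂ = x 1F
    x₃ = x 2F
    x₄ = x 3F
    x₅ = x 4F
    y₁ = y 0F
    y₂ = y 1F
    y₃ = y 2F
    y₄ = y 3F

  P : BiquadraticForm
  P = record
    { polynomial =
        x₁ ^ 2 * y₁ ^ 2 + x₁ ^ 2 * y₂ ^ 2 + x₁ ^ 2 * y₃ ^ 2
      + x₂ ^ 2 * y₁ ^ 2 + x₂ ^ 2 * y₄ ^ 2
      + x₃ ^ 2 * y₂ ^ 2 + x₃ ^ 2 * y₄ ^ 2
      + x₄ ^ 2 * y₃ ^ 2 + x₄ ^ 2 * y₄ ^ 2
      + x₅ ^ 2 * y₁ ^ 2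
      + (x₂ * y₃ + x₅ * y₄) ^ 2
      + (x₄ + x₅) ^ 2 * y₂ ^ 2
    ; isBiquadraticForm =
        square 0F 0F ⊕ square 0F 1F ⊕ square 0F 2F
      ⊕ square 1F 0F ⊕ square 1F 3F
      ⊕ square 2F 1F ⊕ square 2F 3F
      ⊕ square 3F 2F ⊕ square 3F 3F
      ⊕ square 4F 0F
      ⊕ square-of-sum 1F 2F 4F 3F
      ⊕ sum-squared 3F 4F 1F
    }

{-# OPTIONS --safe #-}
module Submission where

-- If P = Σₖ ℓₖ² with s squares, let v i j ∈ ℝˢ collect the coefficients of
-- xᵢyⱼ in the ℓₖ.  Comparing coefficients gives all the sums
-- v i j ∙ v k l + v i l ∙ v k j.  Hence six of the twenty vectors vanish, the
-- others are unit vectors, v 2 3 = v 5 4 and v 4 2 = v 5 2 (inner product 1),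
-- and the twelve remaining vectors turn out to be pairwise orthogonal.  With M
-- the orthogonal projection onto their span, ‖1 - M‖² = s - 12, so 12 ≤ s.

open import Defs

open import Algebra.Apartness.Bundles using (HeytingCommutativeRing)
import Algebra.Apartness.Properties.HeytingCommutativeRing
open import Algebra.Apartness.Structures using (IsHeytingField)
open import Algebra.Bundles using (CommutativeRing)
import Algebra.Properties.Ring
import Algebra.Properties.Semiring.Mult
import Algebra.Properties.Semiring.Sum
import Algebra.Solver.Ring.NaturalCoefficients.Default
open import Data.Bool.Base using (T; _∨_)
open import Data.Bool.Properties using (T?)
open import Data.Fin.Base using (Fin; zero; suc)
open import Data.Fin.Patterns using (0F; 1F; 2F; 3F; 4F)
open import Data.Fin.Properties using (_≟_; all?)
open import Data.Maybe.Base using (Maybe; just; nothing; is-just; _<∣>_; map)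
open import Data.Nat.Base as ℕ using (ℕ)
import Data.Nat.Properties as ℕₚ
open import Data.Product.Base using (∃; _×_; _,_; proj₁; proj₂)
open import Data.Sum.Base using (_⊎_; inj₁; inj₂; [_,_])
open import Data.Vec.Base using (Vec; []; _∷_; lookup)
open import Data.Vec.Relation.Unary.All using (All; []; _∷_)
import Data.Vec.Relation.Unary.All.Properties as All
open import Function.Base using (_∘_; _∘′_)
open import Relation.Binary.PropositionalEquality.Core as ≡ using (_≡_; _≢_)
import Relation.Binary.Reasoning.Setoid
open import Relation.Binary.Structures using (IsStrictPartialOrder)
open import Relation.Nullary.Decidable using (Dec; does; dec⇒maybe; toWitness; yes; no)
open import Relation.Nullary.Negation using (¬_; contradiction)

-- Unit vectors with natural entries.

-- Valued in ℕ rather than in the field, so that values of the form at sums of unit vectors compute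
-- and statements about its coefficients can be decided.
e : ∀ {n} → Fin n → Fin n → ℕ
e zero    zero    = 1
e zero    (suc _) = 0
e (suc _) zero    = 0
e (suc i) (suc j) = e i j

e-diag : ∀ {n} (i : Fin n) → e i i ≡ 1
e-diag zero    = ≡.refl
e-diag (suc i) = e-diag i

e-off : ∀ {n} (i j : Fin n) → i ≢ j → e i j ≡ 0
e-off zero    zero    i≢j = contradiction ≡.refl i≢j
e-off zero    (suc j) _   = ≡.refl
e-off (suc i) zero    _   = ≡.refl
e-off (suc i) (suc j) i≢j = e-off i j (i≢j ∘ ≡.cong suc)

infixl 6 _⊹_
_⊹_ : ∀ {n} → (Fin n → ℕ) → (Fin n → ℕ) → Fin n → ℕ
(p ⊹ q) i = p i ℕ.+ q i

-- Dot products over a commutative ring.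

module Dot {c ℓ} (R : CommutativeRing c ℓ) where
  open CommutativeRing R hiding (zero)
  open Algebra.Properties.Semiring.Sum semiring public
    using ( sum-syntax; sum-cong-≋; sum-replicate; ∑-distrib-+; ∑-comm
          ; *-distribˡ-sum; *-distribʳ-sum)
  open Algebra.Properties.Semiring.Mult semiring using (×-congˡ; ×-homo-+; ×1-homo-*)
    renaming (_×_ to _·_)
  open Algebra.Properties.Ring ring using (+-cancelʳ)
    renaming (//-rightDividesˡ to x-y+y≈x)
  open Algebra.Solver.Ring.NaturalCoefficients.Default commutativeSemiring
    using (solve; _:=_; _:+_; _:*_)
  open Relation.Binary.Reasoning.Setoid setoid

  ι : ℕ → Carrier
  ι n = n · 1#

  ι-+ : ∀ m n → ι (m ℕ.+ n) ≈ ι m + ι n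
  ι-+ = ×-homo-+ 1#

  ι-cong : ∀ {m n} → m ≡ n → ι m ≈ ι n
  ι-cong = ×-congˡ

  infix 8 _∙_
  _∙_ : ∀ {s} → (Fin s → Carrier) → (Fin s → Carrier) → Carrier
  _∙_ {s} u v = ∑[ k < s ] (u k * v k)

  ∙-cong : ∀ {s} {u u′ v v′ : Fin s → Carrier} →
           (∀ k → u k ≈ u′ k) → (∀ k → v k ≈ v′ k) → u ∙ v ≈ u′ ∙ v′
  ∙-cong {s} u≈ v≈ = sum-cong-≋ {s} λ k → *-cong (u≈ k) (v≈ k)

  ∙-comm : ∀ {s} (u v : Fin s → Carrier) → u ∙ v ≈ v ∙ u
  ∙-comm {s} u v = sum-cong-≋ {s} λ k → *-comm (u k) (v k)

  sum-zero : ∀ {n} {f : Fin n → Carrier} → (∀ i → f i ≈ 0#) → ∑[ i < n ] f i ≈ 0#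
  sum-zero {ℕ.zero}  f≈0 = refl
  sum-zero {ℕ.suc n} f≈0 = trans (+-cong (f≈0 zero) (sum-zero (f≈0 ∘ suc))) (+-identityˡ 0#)

  ∑-e : ∀ {n} (i : Fin n) (f : Fin n → Carrier) → ∑[ j < n ] (ι (e i j) * f j) ≈ f i
  ∑-e zero f = trans
    (+-cong (trans (*-congʳ (+-identityʳ 1#)) (*-identityˡ _)) (sum-zero λ j → zeroˡ (f (suc j))))
    (+-identityʳ _)
  ∑-e (suc i) f = trans (+-cong (zeroˡ _) (∑-e i (f ∘ suc))) (+-identityˡ _)

  -- Substituting `r + y` for `x` leaves an identity free of subtraction, which the semiring solver
  -- proves.
  square-of-difference : ∀ x y → (x - y) * (x - y) + (x * y + x * y) ≈ x * x + y * y
  square-of-difference x y = begin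
    r * r + (x * y + x * y)
      ≈⟨ +-congˡ (+-cong (*-congʳ x≈r+y) (*-congʳ x≈r+y)) ⟩
    r * r + ((r + y) * y + (r + y) * y)
      ≈⟨ solve 2 (λ r y → r :* r :+ ((r :+ y) :* y :+ (r :+ y) :* y)
                      := (r :+ y) :* (r :+ y) :+ y :* y) refl r y ⟩
    (r + y) * (r + y) + y * y
      ≈⟨ +-congʳ (*-cong x≈r+y x≈r+y) ⟨
    x * x + y * y ∎
    where
    r = x - y
    x≈r+y : x ≈ r + y
    x≈r+y = sym (x-y+y≈x y x)

  ∙-difference : ∀ {s} (u v : Fin s → Carrier) → let r = λ k → u k - v k in
                 r ∙ r + (u ∙ v + u ∙ v) ≈ u ∙ u + v ∙ v
  ∙-difference {s} u v = begin
    r ∙ r + (u ∙ v + u ∙ v)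
      ≈⟨ +-congˡ (∑-distrib-+ {s} _ _) ⟨
    r ∙ r + ∑[ k < s ] (u k * v k + u k * v k)
      ≈⟨ ∑-distrib-+ {s} _ _ ⟨
    ∑[ k < s ] (r k * r k + (u k * v k + u k * v k))
      ≈⟨ sum-cong-≋ {s} (λ k → square-of-difference (u k) (v k)) ⟩
    ∑[ k < s ] (u k * u k + v k * v k)
      ≈⟨ ∑-distrib-+ {s} _ _ ⟩
    u ∙ u + v ∙ v ∎
    where
    r : Fin s → Carrier
    r k = u k - v k

  infixl 6 _⊕_
  _⊕_ : ∀ {s} → (Fin s → Carrier) → (Fin s → Carrier) → Fin s → Carrier
  (u ⊕ v) k = u k + v k

  ∙-⊕ : ∀ {s} (u v w : Fin s → Carrier) → u ∙ (v ⊕ w) ≈ u ∙ v + u ∙ w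
  ∙-⊕ {s} u v w = trans (sum-cong-≋ {s} λ k → distribˡ (u k) (v k) (w k)) (∑-distrib-+ {s} _ _)

  ⊕-∙-⊕ : ∀ {s} (u v w z : Fin s → Carrier) →
          (u ⊕ v) ∙ (w ⊕ z) ≈ (u ∙ w + v ∙ w) + (u ∙ z + v ∙ z)
  ⊕-∙-⊕ u v w z = trans (∙-⊕ (u ⊕ v) w z) (+-cong (⊕-∙ w) (⊕-∙ z))
    where
    ⊕-∙ : ∀ x → (u ⊕ v) ∙ x ≈ u ∙ x + v ∙ x
    ⊕-∙ x = trans (∙-comm (u ⊕ v) x) (trans (∙-⊕ x u v) (+-cong (∙-comm x u) (∙-comm x v)))

  norm-⊕ : ∀ {s} (u v : Fin s → Carrier) →
           (u ⊕ v) ∙ (u ⊕ v) ≈ u ∙ u + v ∙ v + (u ∙ v + u ∙ v)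
  norm-⊕ u v = trans (⊕-∙-⊕ u v u v) (trans (+-congʳ (+-congˡ (∙-comm v u)))
    (solve 3 (λ a b c → (a :+ c) :+ (c :+ b) := a :+ b :+ (c :+ c)) refl _ _ _))

  -- With the four vectors at the corners of a rectangle, the products along its edges cancel and
  -- only the two diagonal products remain, each twice. This expresses them through squared norms,
  -- which are values of the form.
  second-difference : ∀ {s} (α β γ δ : Fin s → Carrier) →
    (α ⊕ β ⊕ (γ ⊕ δ)) ∙ (α ⊕ β ⊕ (γ ⊕ δ)) + (α ∙ α + β ∙ β + γ ∙ γ + δ ∙ δ)
    ≈ (α ⊕ γ) ∙ (α ⊕ γ) + (β ⊕ δ) ∙ (β ⊕ δ) + (α ⊕ β) ∙ (α ⊕ β) + (γ ⊕ δ) ∙ (γ ⊕ δ)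
    + ((α ∙ δ + β ∙ γ) + (α ∙ δ + β ∙ γ))
  second-difference α β γ δ = trans
    (+-congʳ (trans (norm-⊕ (α ⊕ β) (γ ⊕ δ))
      (+-cong (+-cong (norm-⊕ α β) (norm-⊕ γ δ)) (+-cong (⊕-∙-⊕ α β γ δ) (⊕-∙-⊕ α β γ δ)))))
    (trans
      (solve 10 (λ αα ββ γγ δδ αβ αγ αδ βγ βδ γδ →
        αα :+ ββ :+ (αβ :+ αβ) :+ (γγ :+ δδ :+ (γδ :+ γδ))
          :+ ((αγ :+ βγ) :+ (αδ :+ βδ) :+ ((αγ :+ βγ) :+ (αδ :+ βδ)))
          :+ (αα :+ ββ :+ γγ :+ δδ)
        := αα :+ γγ :+ (αγ :+ αγ) :+ (ββ :+ δδ :+ (βδ :+ βδ))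
          :+ (αα :+ ββ :+ (αβ :+ αβ)) :+ (γγ :+ δδ :+ (γδ :+ γδ))
          :+ ((αδ :+ βγ) :+ (αδ :+ βγ)))
        refl (α ∙ α) (β ∙ β) (γ ∙ γ) (δ ∙ δ) (α ∙ β) (α ∙ γ) (α ∙ δ) (β ∙ γ) (β ∙ δ) (γ ∙ δ))
      (sym (+-congʳ (+-cong (+-cong (+-cong
        (norm-⊕ α γ) (norm-⊕ β δ)) (norm-⊕ α β)) (norm-⊕ γ δ)))))

  -- A record rather than a bare equation, so that `n` stays inferable when derivations are combined
  -- by `_⊞_` and `_⊠_`.
  record _IsNatural_ (x : Carrier) (n : ℕ) : Set ℓ where
    constructor natural
    field value : x ≈ ι n

  open _IsNatural_ public

  infixl 6 _⊞_
  _⊞_ : ∀ {x y m n} → x IsNatural m → y IsNatural n → (x + y) IsNatural (m ℕ.+ n)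
  _⊞_ {m = m} {n} (natural x≈m) (natural y≈n) =
    natural (trans (+-cong x≈m y≈n) (sym (ι-+ m n)))

  infixl 7 _⊠_
  _⊠_ : ∀ {x y m n} → x IsNatural m → y IsNatural n → (x * y) IsNatural (m ℕ.* n)
  _⊠_ {m = m} {n} (natural x≈m) (natural y≈n) =
    natural (trans (*-cong x≈m y≈n) (sym (×1-homo-* m n)))

  -- Values of a bilinear form at natural points.

  module Bilinear {m n} (a : Fin m → Fin n → Carrier) where

    B : (Fin m → ℕ) → (Fin n → ℕ) → Carrier
    B p q = ∑[ i < m ] ∑[ j < n ] (a i j * ι (p i) * ι (q j))

    B-+ˡ : ∀ p p′ q → B (p ⊹ p′) q ≈ B p q + B p′ q
    B-+ˡ p p′ q = trans
      (sum-cong-≋ {m} λ i → trans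
        (sum-cong-≋ {n} λ j → trans
          (*-congʳ (trans (*-congˡ (ι-+ (p i) (p′ i))) (distribˡ _ _ _)))
          (distribʳ _ _ _))
        (∑-distrib-+ {n} _ _))
      (∑-distrib-+ {m} _ _)

    B-+ʳ : ∀ p q q′ → B p (q ⊹ q′) ≈ B p q + B p q′
    B-+ʳ p q q′ = trans
      (sum-cong-≋ {m} λ i → trans
        (sum-cong-≋ {n} λ j → trans (*-congˡ (ι-+ (q j) (q′ j))) (distribˡ _ _ _))
        (∑-distrib-+ {n} _ _))
      (∑-distrib-+ {m} _ _)

    B-e : ∀ i j → B (e i) (e j) ≈ a i j
    B-e i j = trans
      (sum-cong-≋ {m} λ i′ → trans
        (sum-cong-≋ {n} λ j′ → *-comm _ _)
        (trans (∑-e j λ j′ → a i′ j′ * ι (e i i′)) (*-comm _ _)))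
      (∑-e i λ i′ → a i′ j)

  -- The orthogonal projection onto the span of an orthonormal family.

  module Projection {n s} (w : Fin n → Fin s → Carrier)
    (orthonormal : ∀ p q → w p ∙ w q ≈ ι (e p q)) where

    M : Fin s → Fin s → Carrier
    M k l = ∑[ p < n ] (w p k * w p l)

    residual : Fin s → Fin s → Carrier
    residual k l = ι (e k l) - M k l

    M-fixes : ∀ k p → M k ∙ w p ≈ w p k
    M-fixes k p = begin
      ∑[ l < s ] (M k l * w p l)
        ≈⟨ sum-cong-≋ {s} (λ l → *-distribʳ-sum {n} (w p l) _) ⟩
      ∑[ l < s ] ∑[ q < n ] (w q k * w q l * w p l)
        ≈⟨ ∑-comm {s} {n} _ ⟩
      ∑[ q < n ] ∑[ l < s ] (w q k * w q l * w p l)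
        ≈⟨ sum-cong-≋ {n} (λ q → trans (sum-cong-≋ {s} λ l → *-assoc _ _ _)
             (sym (*-distribˡ-sum {s} (w q k) _))) ⟩
      ∑[ q < n ] (w q k * w q ∙ w p)
        ≈⟨ sum-cong-≋ {n} (λ q → trans (*-comm _ _)
             (*-congʳ (trans (∙-comm (w q) (w p)) (orthonormal p q)))) ⟩
      ∑[ q < n ] (ι (e p q) * w q k)
        ≈⟨ ∑-e p (λ q → w q k) ⟩
      w p k ∎

    -- Since `M` is symmetric, this is the diagonal of M² = M. Expanding one factor into its
    -- rank-one terms reduces it to `M-fixes`.
    M-idempotent : ∀ k → M k ∙ M k ≈ M k k
    M-idempotent k = begin
      ∑[ l < s ] (M k l * M k l)
        ≈⟨ sum-cong-≋ {s} (λ l → *-distribˡ-sum {n} (M k l) _) ⟩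
      ∑[ l < s ] ∑[ p < n ] (M k l * (w p k * w p l))
        ≈⟨ ∑-comm {s} {n} _ ⟩
      ∑[ p < n ] ∑[ l < s ] (M k l * (w p k * w p l))
        ≈⟨ sum-cong-≋ {n} (λ p → trans (sum-cong-≋ {s} λ l →
             solve 3 (λ a b c → a :* (b :* c) := b :* (a :* c)) refl _ _ _)
             (sym (*-distribˡ-sum {s} (w p k) _))) ⟩
      ∑[ p < n ] (w p k * M k ∙ w p)
        ≈⟨ sum-cong-≋ {n} (λ p → *-congˡ (M-fixes k p)) ⟩
      M k k ∎

    -- The squared distance from the k-th unit vector to row k of `M` is 1 - 2 M k k + M k k, by
    -- `M-idempotent`.
    residual-norm : ∀ k → residual k ∙ residual k + M k k ≈ 1#
    residual-norm k = +-cancelʳ (M k k) _ _ (begin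
      residual k ∙ residual k + M k k + M k k
        ≈⟨ +-assoc _ _ _ ⟩
      residual k ∙ residual k + (M k k + M k k)
        ≈⟨ +-congˡ (+-cong (∑-e k (M k)) (∑-e k (M k))) ⟨
      residual k ∙ residual k + (ek ∙ M k + ek ∙ M k)
        ≈⟨ ∙-difference ek (M k) ⟩
      ek ∙ ek + M k ∙ M k
        ≈⟨ +-cong (∑-e k ek) (M-idempotent k) ⟩
      ι (e k k) + M k k
        ≈⟨ +-congʳ (trans (ι-cong (e-diag k)) (+-identityʳ 1#)) ⟩
      1# + M k k ∎)
      where
      ek : Fin s → Carrier
      ek l = ι (e k l)

    trace-M : ∑[ k < s ] M k k ≈ ι n
    trace-M = begin
      ∑[ k < s ] M k k
        ≈⟨ ∑-comm {s} {n} _ ⟩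
      ∑[ p < n ] (w p ∙ w p)
        ≈⟨ sum-cong-≋ {n} (λ p → trans (orthonormal p p)
             (trans (ι-cong (e-diag p)) (+-identityʳ 1#))) ⟩
      ∑[ p < n ] 1#
        ≈⟨ sum-replicate n ⟩
      ι n ∎

    -- Sums `residual-norm` over the rows. The trace of `M` is `ι n`, because exchanging the sums
    -- turns it into the sum of the squared norms of the `w p`.
    residual-trace : ∑[ k < s ] (residual k ∙ residual k) + ι n ≈ ι s
    residual-trace = begin
      ∑[ k < s ] (residual k ∙ residual k) + ι n
        ≈⟨ +-congˡ trace-M ⟨
      ∑[ k < s ] (residual k ∙ residual k) + ∑[ k < s ] M k k
        ≈⟨ ∑-distrib-+ {s} _ _ ⟨
      ∑[ k < s ] (residual k ∙ residual k + M k k)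
        ≈⟨ sum-cong-≋ {s} residual-norm ⟩
      ∑[ k < s ] 1#
        ≈⟨ sum-replicate s ⟩
      ι s ∎

-- Positivity in an ordered field without decidable order.

module Ordered {c ℓ₁ ℓ₂} (F : OrderedField c ℓ₁ ℓ₂) where
  open OrderedField F
  open CommutativeRing commutativeRing
    hiding (zero; Carrier; _≈_; _+_; _*_; -_; 0#; 1#)
  open IsHeytingField isHeytingField
    using (isHeytingCommutativeRing; tight; #-irrefl; #-cotrans)
  module < = IsStrictPartialOrder isStrictPartialOrder

  heytingCommutativeRing : HeytingCommutativeRing c ℓ₁ ℓ₂
  heytingCommutativeRing = record { isHeytingCommutativeRing = isHeytingCommutativeRing }

  open Algebra.Apartness.Properties.HeytingCommutativeRing heytingCommutativeRing
    using (1#0; x#0y#0→xy#0)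
  open Algebra.Properties.Ring ring using (-‿involutive; -‿distribˡ-*; -‿distribʳ-*; +-cancelʳ)
    renaming (x∙y⁻¹≈ε⇒x≈y to x-y≈0⇒x≈y; //-rightDividesʳ to x+y-y≈x)
  open Dot commutativeRing

  ≈-tight : ∀ {x y} → ¬ (x # y) → x ≈ y
  ≈-tight = proj₁ (tight _ _)

  <-respˡ : ∀ {x y z} → x ≈ y → x < z → y < z
  <-respˡ = proj₂ <.<-resp-≈

  <-respʳ : ∀ {x y z} → x ≈ y → z < x → z < y
  <-respʳ = proj₁ <.<-resp-≈

  +-monoʳ-< : ∀ {x y} z → x < y → z + x < z + y
  +-monoʳ-< z x<y = <-respˡ (+-comm _ _) (<-respʳ (+-comm _ _) (+-monoˡ-< z x<y))

  +-cancelʳ-< : ∀ {x y} z → x + z < y + z → x < y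
  +-cancelʳ-< z lt = <-respˡ (x+y-y≈x z _) (<-respʳ (x+y-y≈x z _) (+-monoˡ-< (- z) lt))

  negative⇒-positive : ∀ {x} → x < 0# → 0# < - x
  negative⇒-positive {x} x<0 =
    <-respˡ (-‿inverseʳ x) (<-respʳ (+-identityˡ _) (+-monoˡ-< (- x) x<0))

  #0⇒square-positive : ∀ {x} → x # 0# → 0# < x * x
  #0⇒square-positive (inj₂ 0<x) = *-positive 0<x 0<x
  #0⇒square-positive {x} (inj₁ x<0) = <-respʳ
    (trans (sym (-‿distribˡ-* x (- x))) (trans (-‿cong (sym (-‿distribʳ-* x x))) (-‿involutive _)))
    (*-positive (negative⇒-positive x<0) (negative⇒-positive x<0))

  0<1 : 0# < 1#
  0<1 = <-respʳ (*-identityˡ 1#) (#0⇒square-positive 1#0)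

  NonNegative : Carrier → Set ℓ₂
  NonNegative x = ¬ (x < 0#)

  -- If the square were negative, `x` could not be apart from 0, as its square would then be
  -- positive. Tightness gives `x ≈ 0`, so the square is 0 after all.
  square-nonNegative : ∀ x → NonNegative (x * x)
  square-nonNegative x xx<0 = <.irrefl (trans (*-congʳ x≈0) (zeroˡ x)) xx<0
    where
    x≈0 : x ≈ 0#
    x≈0 = ≈-tight λ x#0 → <.irrefl refl (<.trans (#0⇒square-positive x#0) xx<0)

  x+y<x⇒y<0 : ∀ {x y} → x + y < x → y < 0#
  x+y<x⇒y<0 {x} x+y<x =
    +-cancelʳ-< x (<-respˡ (+-comm _ _) (<-respʳ (sym (+-identityˡ x)) x+y<x))

  -- In place of a case split on signs, cotransitivity yields that `x` is apart from `x + y` or from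
  -- 0. Each of the four resulting inequalities makes `x` or `y` negative.
  +-nonNegative : ∀ {x y} → NonNegative x → NonNegative y → NonNegative (x + y)
  +-nonNegative {x} {y} 0≤x 0≤y x+y<0 with #-cotrans (inj₁ x+y<0) x
  ... | inj₂ (inj₁ x<0)   = 0≤x x<0
  ... | inj₂ (inj₂ 0<x)   = 0≤y (x+y<x⇒y<0 (<.trans x+y<0 0<x))
  ... | inj₁ (inj₁ x+y<x) = 0≤y (x+y<x⇒y<0 x+y<x)
  ... | inj₁ (inj₂ x<x+y) = 0≤x (<.trans x<x+y x+y<0)

  sum-nonNegative : ∀ {n} {f : Fin n → Carrier} →
                    (∀ i → NonNegative (f i)) → NonNegative (∑[ i < n ] f i)
  sum-nonNegative {ℕ.zero}  _   = <.irrefl refl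
  sum-nonNegative {ℕ.suc n} 0≤f = +-nonNegative (0≤f zero) (sum-nonNegative (0≤f ∘ suc))

  ∙-nonNegative : ∀ {s} (u : Fin s → Carrier) → NonNegative (u ∙ u)
  ∙-nonNegative u = sum-nonNegative λ k → square-nonNegative (u k)

  nonNegative-+≈0 : ∀ {x y} → NonNegative x → NonNegative y → x + y ≈ 0# → x ≈ 0#
  nonNegative-+≈0 {x} {y} 0≤x 0≤y x+y≈0 = ≈-tight
    [ 0≤x , (λ 0<x → 0≤y (<-respʳ x+y≈0 (<-respˡ (+-identityˡ y) (+-monoˡ-< y 0<x)))) ]

  sum≈0 : ∀ {n} {f : Fin n → Carrier} → (∀ i → NonNegative (f i)) →
          ∑[ i < n ] f i ≈ 0# → ∀ i → f i ≈ 0#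
  sum≈0 0≤f Σ≈0 zero    = nonNegative-+≈0 (0≤f zero) (sum-nonNegative (0≤f ∘ suc)) Σ≈0
  sum≈0 0≤f Σ≈0 (suc i) = sum≈0 (0≤f ∘ suc)
    (nonNegative-+≈0 (sum-nonNegative (0≤f ∘ suc)) (0≤f zero) (trans (+-comm _ _) Σ≈0)) i

  -- Every term of a vanishing sum of squares vanishes, whereas an entry apart from 0 would have a
  -- square apart from 0.
  ∙≈0⇒≈0 : ∀ {s} (u : Fin s → Carrier) → u ∙ u ≈ 0# → ∀ k → u k ≈ 0#
  ∙≈0⇒≈0 u uu≈0 k = ≈-tight λ uk#0 →
    #-irrefl (sum≈0 (λ k → square-nonNegative (u k)) uu≈0 k) (x#0y#0→xy#0 uk#0 uk#0)

  -- Doubling is strictly monotone, which excludes both `x < y` and `y < x`; tightness does the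
  -- rest.
  halve : ∀ {x y} → x + x ≈ y + y → x ≈ y
  halve 2x≈2y = ≈-tight
    [ (λ x<y → <.irrefl 2x≈2y (double x<y)) , (λ y<x → <.irrefl (sym 2x≈2y) (double y<x)) ]
    where
    double : ∀ {x y} → x < y → x + x < y + y
    double x<y = <.trans (+-monoˡ-< _ x<y) (+-monoʳ-< _ x<y)

  ι-mono-< : ∀ {m n} → m ℕ.< n → ι m < ι n
  ι-mono-< {ℕ.zero}  {ℕ.suc ℕ.zero} _ = <-respʳ (sym (+-identityʳ 1#)) 0<1
  ι-mono-< {ℕ.zero}  {ℕ.suc (ℕ.suc n)} _ = <.trans (ι-mono-< {0} {ℕ.suc n} (ℕ.s≤s ℕ.z≤n))
    (<-respˡ (+-identityˡ _) (+-monoˡ-< _ 0<1))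
  ι-mono-< {ℕ.suc m} {ℕ.suc n} (ℕ.s≤s m<n) = +-monoʳ-< 1# (ι-mono-< m<n)

  -- The equality case of the Cauchy-Schwarz inequality: the squared norm of `u - v` is 1 + 1 - 2 =
  -- 0.
  equal-unit-vectors : ∀ {s} (u v : Fin s → Carrier) → u ∙ u ≈ 1# → v ∙ v ≈ 1# → u ∙ v ≈ 1# →
                       ∀ k → u k ≈ v k
  equal-unit-vectors u v uu≈1 vv≈1 uv≈1 k = x-y≈0⇒x≈y _ _ (∙≈0⇒≈0 r rr≈0 k)
    where
    r : Fin _ → Carrier
    r k = u k - v k
    rr≈0 : r ∙ r ≈ 0#
    rr≈0 = +-cancelʳ (1# + 1#) _ _ (trans (+-congˡ (sym (+-cong uv≈1 uv≈1)))
      (trans (∙-difference u v) (trans (+-cong uu≈1 vv≈1) (sym (+-identityˡ _)))))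

  -- If `s < n`, then `residual-trace` would make a sum of squares equal to the negative number s -
  -- n.
  orthonormal⇒≤ : ∀ {n s} (w : Fin n → Fin s → Carrier) →
                  (∀ p q → w p ∙ w q ≈ ι (e p q)) → n ℕ.≤ s
  orthonormal⇒≤ {n} {s} w orthonormal = ℕₚ.≮⇒≥ λ s<n →
    sum-nonNegative (λ k → ∙-nonNegative (residual k))
      (+-cancelʳ-< (ι n) (<-respˡ (sym residual-trace)
        (<-respʳ (sym (+-identityˡ _)) (ι-mono-< s<n))))
    where open Projection w orthonormal

-- Values of the form at natural points.

module Values where
  open import Data.Nat.Base using (_+_; _*_; _^_)

  -- Bracketed exactly like the polynomial of `P`, so that `P-value` can follow it term by term.
  Pℕ : (Fin 5 → ℕ) → (Fin 4 → ℕ) → ℕ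
  Pℕ x y =
      x 0F ^ 2 * y 0F ^ 2 + x 0F ^ 2 * y 1F ^ 2 + x 0F ^ 2 * y 2F ^ 2
    + x 1F ^ 2 * y 0F ^ 2 + x 1F ^ 2 * y 3F ^ 2
    + x 2F ^ 2 * y 1F ^ 2 + x 2F ^ 2 * y 3F ^ 2
    + x 3F ^ 2 * y 2F ^ 2 + x 3F ^ 2 * y 3F ^ 2
    + x 4F ^ 2 * y 0F ^ 2
    + (x 1F * y 2F + x 4F * y 3F) ^ 2
    + (x 3F + x 4F) ^ 2 * y 1F ^ 2

open Values using (Pℕ)

-- Polarised coefficients and the search for orthogonality derivations.

Cell : Set
Cell = Fin 5 × Fin 4

-- The second difference of P in both arguments is twice the polarised
-- coefficient; its negative terms are moved to the other side.
HasCoefficient : Cell → Cell → ℕ → Set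
HasCoefficient (i , j) (k , l) t =
  Pℕ (e i ⊹ e k) (e j ⊹ e l)
    ℕ.+ (Pℕ (e i) (e j) ℕ.+ Pℕ (e i) (e l) ℕ.+ Pℕ (e k) (e j) ℕ.+ Pℕ (e k) (e l))
  ≡ (Pℕ (e i ⊹ e k) (e j) ℕ.+ Pℕ (e i ⊹ e k) (e l)
    ℕ.+ Pℕ (e i) (e j ⊹ e l) ℕ.+ Pℕ (e k) (e j ⊹ e l)) ℕ.+ (t ℕ.+ t)

vanishes? : ∀ c d → Maybe (HasCoefficient c d 0)
vanishes? c d = dec⇒maybe (_ ℕₚ.≟ _)

-- Cells with equal vectors.
data Twin : Cell → Cell → Set where
  twin₂₃   : Twin (1F , 2F) (4F , 3F)
  twin₄₂   : Twin (3F , 1F) (4F , 1F)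
  twin-sym : ∀ {c d} → Twin c d → Twin d c

twin? : ∀ c → Maybe (∃ (Twin c))
twin? (1F , 2F) = just (_ , twin₂₃)
twin? (3F , 1F) = just (_ , twin₄₂)
twin? (4F , 3F) = just (_ , twin-sym twin₂₃)
twin? (4F , 1F) = just (_ , twin-sym twin₄₂)
twin? _         = nothing

-- Derivations of orthogonality: a pair of cells with vanishing polarised
-- coefficient is orthogonal as soon as the opposite corners of its rectangle are.
infix 4 _⊥_
data _⊥_ : Cell → Cell → Set where
  ⊥-sym  : ∀ {c d} → c ⊥ d → d ⊥ c
  ⊥-zero : ∀ {c d} → HasCoefficient c c 0 → c ⊥ d
  ⊥-row  : ∀ {i j l} → HasCoefficient (i , j) (i , l) 0 → (i , j) ⊥ (i , l)
  ⊥-col  : ∀ {i j k} → HasCoefficient (i , j) (k , j) 0 → (i , j) ⊥ (k , j)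
  ⊥-rect : ∀ {i j k l} → HasCoefficient (i , j) (k , l) 0 →
           (i , l) ⊥ (k , j) → (i , j) ⊥ (k , l)
  ⊥-twin : ∀ {c c′ d} → Twin c c′ → c′ ⊥ d → c ⊥ d

⊥-line? : ∀ c d → Maybe (c ⊥ d)
⊥-line? (i , j) (k , l) with i ≟ k | j ≟ l
... | yes ≡.refl | _          = map ⊥-row (vanishes? (i , j) (i , l))
... | no _       | yes ≡.refl = map ⊥-col (vanishes? (i , j) (k , j))
... | no _       | no _       = nothing

-- The first argument bounds the depth of the search; 6 is the least bound that
-- works for all pairs of distinct cells in the list below.
⊥? : ℕ → ∀ c d → Maybe (c ⊥ d)
⊥? ℕ.zero      c d = nothing
⊥? (ℕ.suc n) c@(i , j) d@(k , l) =
  map ⊥-zero (vanishes? c c)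
  <∣> map (⊥-sym ∘′ ⊥-zero) (vanishes? d d)
  <∣> ⊥-line? c d
  <∣> rect
  <∣> twinˡ (twin? c)
  <∣> twinʳ (twin? d)
  where
  rect : Maybe (c ⊥ d)
  rect with vanishes? c d
  ... | just h  = map (⊥-rect h) (⊥? n (i , l) (k , j))
  ... | nothing = nothing
  twinˡ : Maybe (∃ (Twin c)) → Maybe (c ⊥ d)
  twinˡ (just (c′ , t)) = map (⊥-twin t) (⊥? n c′ d)
  twinˡ nothing         = nothing
  twinʳ : Maybe (∃ (Twin d)) → Maybe (c ⊥ d)
  twinʳ (just (d′ , t)) = map (⊥-sym ∘′ ⊥-twin t ∘′ ⊥-sym) (⊥? n c d′)
  twinʳ nothing         = nothing

-- Fourteen monomials have a nonzero square coefficient. One cell of each twin pair is kept, which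
-- leaves out `(4F , 3F)` and `(4F , 1F)`.
cells : Vec Cell 12
cells =
    (0F , 0F) ∷ (0F , 1F) ∷ (0F , 2F)
  ∷ (1F , 0F) ∷ (1F , 2F) ∷ (1F , 3F)
  ∷ (2F , 1F) ∷ (2F , 3F)
  ∷ (3F , 1F) ∷ (3F , 2F) ∷ (3F , 3F)
  ∷ (4F , 0F) ∷ []

cell : Fin 12 → Cell
cell = lookup cells

-- The value is 2 because the polarised sum of a cell with itself counts its squared norm twice.
cell-unit : ∀ p → HasCoefficient (cell p) (cell p) 2
cell-unit = toWitness {a? = all? λ p → _ ℕₚ.≟ _} _

-- The success of the search is checked only as a Boolean; this recovers the derivation that was
-- found.
select : ∀ {a b} {A : Set a} {B : Set b} (a? : Dec A) (b? : Maybe B) →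
         T (does a? ∨ is-just b?) → ¬ A → B
select (yes a) _        _ ¬a = contradiction a ¬a
select (no _)  (just b) _ _  = b

cell-⊥ : ∀ p q → p ≢ q → cell p ⊥ cell q
cell-⊥ p q = select (p ≟ q) (⊥? 6 (cell p) (cell q)) (table p q)
  where
  table : ∀ p q → T (does (p ≟ q) ∨ is-just (⊥? 6 (cell p) (cell q)))
  -- The last argument is filled by evaluating the decision on all 144 pairs; on the diagonal the
  -- first disjunct holds.
  table = toWitness {a? = all? λ p → all? λ q → T? _} _

-- Evaluation of polynomials.

module Evaluation {c ℓ} (R : CommutativeRing c ℓ) {V : Set} where
  open CommutativeRing R hiding (zero)
  open Dot R using (sum-syntax)
  module V = Polynomials R V
  module VSum = Algebra.Properties.Semiring.Sum (CommutativeRing.semiring V.polynomialRing)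

  ⟦_⟧ : V.Polynomial → (V → Carrier) → Carrier
  ⟦ V.con a ⟧ ρ = a
  ⟦ V.var v ⟧ ρ = ρ v
  ⟦ p V.+ q ⟧ ρ = ⟦ p ⟧ ρ + ⟦ q ⟧ ρ
  ⟦ p V.* q ⟧ ρ = ⟦ p ⟧ ρ * ⟦ q ⟧ ρ
  ⟦ V.- p ⟧   ρ = - ⟦ p ⟧ ρ

  ⟦⟧-cong : ∀ {p q} → p V.≋ q → ∀ ρ → ⟦ p ⟧ ρ ≈ ⟦ q ⟧ ρ
  ⟦⟧-cong V.≋-refl            ρ = refl
  ⟦⟧-cong (V.≋-sym h)        ρ = sym (⟦⟧-cong h ρ)
  ⟦⟧-cong (V.≋-trans h h′)    ρ = trans (⟦⟧-cong h ρ) (⟦⟧-cong h′ ρ)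
  ⟦⟧-cong (V.+-cong h h′)     ρ = +-cong (⟦⟧-cong h ρ) (⟦⟧-cong h′ ρ)
  ⟦⟧-cong (V.*-cong h h′)     ρ = *-cong (⟦⟧-cong h ρ) (⟦⟧-cong h′ ρ)
  ⟦⟧-cong (V.-‿cong h)       ρ = -‿cong (⟦⟧-cong h ρ)
  ⟦⟧-cong (V.con-cong a≈b)    ρ = a≈b
  ⟦⟧-cong (V.con-+ a b)       ρ = refl
  ⟦⟧-cong (V.con-* a b)       ρ = refl
  ⟦⟧-cong (V.+-assoc p q r)   ρ = +-assoc _ _ _
  ⟦⟧-cong (V.+-comm p q)      ρ = +-comm _ _
  ⟦⟧-cong (V.+-identityˡ p)   ρ = +-identityˡ _
  ⟦⟧-cong (V.-‿inverseˡ p)    ρ = -‿inverseˡ _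
  ⟦⟧-cong (V.*-assoc p q r)   ρ = *-assoc _ _ _
  ⟦⟧-cong (V.*-comm p q)      ρ = *-comm _ _
  ⟦⟧-cong (V.*-identityˡ p)   ρ = *-identityˡ _
  ⟦⟧-cong (V.distribˡ p q r)  ρ = distribˡ _ _ _

  ⟦⟧-sum : ∀ {n} (f : Fin n → V.Polynomial) ρ →
           ⟦ VSum.sum-syntax n f ⟧ ρ ≡ ∑[ i < n ] ⟦ f i ⟧ ρ
  ⟦⟧-sum {ℕ.zero}  f ρ = ≡.refl
  ⟦⟧-sum {ℕ.suc n} f ρ = ≡.cong (⟦ f zero ⟧ ρ +_) (⟦⟧-sum (f ∘ suc) ρ)

-- The lower bound: coefficient vectors of a sum of squares.

module LowerBound {c ℓ₁ ℓ₂} (ℝ : RealNumbers c ℓ₁ ℓ₂) where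
  open RealNumbers ℝ using (orderedField; commutativeRing)
  open CommutativeRing commutativeRing hiding (zero)
  open Dot commutativeRing
  open Ordered orderedField using (halve; ∙≈0⇒≈0; equal-unit-vectors; orthonormal⇒≤)
  open Evaluation commutativeRing {Fin 5 ⊎ Fin 4}
  open Algebra.Properties.Ring ring using (+-cancelˡ)
  open Relation.Binary.Reasoning.Setoid setoid
  open Forms commutativeRing 5 4 using (Polynomial; _≋_; _^_; IsBilinearForm; polynomial)

  point : (Fin 5 → ℕ) → (Fin 4 → ℕ) → Fin 5 ⊎ Fin 4 → Carrier
  point p q = [ ι ∘ p , ι ∘ q ]

  P-value : ∀ p q → ⟦ polynomial (P ℝ) ⟧ (point p q) IsNatural Pℕ p q
  P-value p q =
      sq (x 0F) ⊠ sq (y 0F) ⊞ sq (x 0F) ⊠ sq (y 1F) ⊞ sq (x 0F) ⊠ sq (y 2F)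
    ⊞ sq (x 1F) ⊠ sq (y 0F) ⊞ sq (x 1F) ⊠ sq (y 3F)
    ⊞ sq (x 2F) ⊠ sq (y 1F) ⊞ sq (x 2F) ⊠ sq (y 3F)
    ⊞ sq (x 3F) ⊠ sq (y 2F) ⊞ sq (x 3F) ⊠ sq (y 3F)
    ⊞ sq (x 4F) ⊠ sq (y 0F)
    ⊞ sq (x 1F ⊠ y 2F ⊞ x 4F ⊠ y 3F)
    ⊞ sq (x 3F ⊞ x 4F) ⊠ sq (y 1F)
    where
    x : ∀ i → ι (p i) IsNatural p i
    x i = natural refl
    y : ∀ j → ι (q j) IsNatural q j
    y j = natural refl
    -- The trailing factor 1 is there because the exponent 2 unfolds to it, in the ring and in ℕ
    -- alike.
    sq : ∀ {z n} → z IsNatural n → (z * (z * 1#)) IsNatural (n ℕ.^ 2)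
    sq z = z ⊠ (z ⊠ natural (sym (+-identityʳ 1#)))

  module _ {s} (f : Fin s → Polynomial) (f-bilinear : ∀ k → IsBilinearForm (f k))
           (P≋ : polynomial (P ℝ) ≋ VSum.sum-syntax s λ k → f k ^ 2) where

    module B k = Bilinear (proj₁ (f-bilinear k))

    v : Cell → Fin s → Carrier
    v (i , j) k = proj₁ (f-bilinear k) i j

    b : (Fin 5 → ℕ) → (Fin 4 → ℕ) → Fin s → Carrier
    b p q k = B.B k p q

    b-value : ∀ p q → (b p q ∙ b p q) IsNatural Pℕ p q
    b-value p q = natural (begin
      b p q ∙ b p q
        ≈⟨ sum-cong-≋ {s} (λ k → *-cong (f-value k) (trans (*-identityʳ _) (f-value k))) ⟨
      ∑[ k < s ] (⟦ f k ⟧ ρ * (⟦ f k ⟧ ρ * 1#))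
        ≡⟨ ⟦⟧-sum {s} (λ k → f k ^ 2) ρ ⟨
      _ ≈⟨ ⟦⟧-cong P≋ ρ ⟨
      ⟦ polynomial (P ℝ) ⟧ ρ
        ≈⟨ value (P-value p q) ⟩
      ι (Pℕ p q) ∎)
      where
      ρ : Fin 5 ⊎ Fin 4 → Carrier
      ρ = point p q
      f-value : ∀ k → ⟦ f k ⟧ ρ ≈ b p q k
      -- For the concrete sizes 5 and 4 the double sum unfolds, and its value at `ρ` is `b p q k` by
      -- definition.
      f-value k = ⟦⟧-cong (proj₂ (f-bilinear k)) ρ

    norm-value : ∀ {u : Fin s → Carrier} p q → (∀ k → b p q k ≈ u k) → (u ∙ u) IsNatural Pℕ p q
    norm-value p q b≈u = natural (trans (sym (∙-cong {s} b≈u b≈u)) (value (b-value p q)))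

    -- All nine squared norms in `second-difference` are values of the form at sums of unit vectors.
    -- The identity `h` in ℕ thus carries over to the field, where cancelling and halving isolate
    -- the diagonal products.
    polarised : ∀ i j k l t → HasCoefficient (i , j) (k , l) t →
                v (i , j) ∙ v (k , l) + v (i , l) ∙ v (k , j) ≈ ι t
    polarised i j k l t h = halve (+-cancelˡ _ _ _ (begin
      _ ≈⟨ second-difference α β γ δ ⟨
      -- The natural number assembled here is literally the left side of `HasCoefficient`, so that
      -- `h` applies next.
      _ ≈⟨ value (norm-value (e i ⊹ e k) (e j ⊹ e l)
                    (λ r → trans (B.B-+ˡ r (e i) (e k) (e j ⊹ e l)) (+-cong (bᵢ i r) (bᵢ k r)))
                  ⊞ (norm i j ⊞ norm i l ⊞ norm k j ⊞ norm k l)) ⟩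
      _ ≈⟨ ι-cong h ⟩
      _ ≈⟨ value (normᵏ j ⊞ normᵏ l ⊞ normˡ i ⊞ normˡ k ⊞ (nat t ⊞ nat t)) ⟨
      _ ∎))
      where
      α = v (i , j)
      β = v (i , l)
      γ = v (k , j)
      δ = v (k , l)
      nat : ∀ n → ι n IsNatural n
      nat n = natural refl
      bᵢ : ∀ i r → b (e i) (e j ⊹ e l) r ≈ (v (i , j) ⊕ v (i , l)) r
      bᵢ i r = trans (B.B-+ʳ r (e i) (e j) (e l)) (+-cong (B.B-e r i j) (B.B-e r i l))
      norm : ∀ i j → (v (i , j) ∙ v (i , j)) IsNatural Pℕ (e i) (e j)
      norm i j = norm-value (e i) (e j) λ r → B.B-e r i j
      normᵏ : ∀ j → ((v (i , j) ⊕ v (k , j)) ∙ (v (i , j) ⊕ v (k , j)))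
                    IsNatural Pℕ (e i ⊹ e k) (e j)
      normᵏ j = norm-value (e i ⊹ e k) (e j) λ r →
        trans (B.B-+ˡ r (e i) (e k) (e j)) (+-cong (B.B-e r i j) (B.B-e r k j))
      normˡ : ∀ i → ((v (i , j) ⊕ v (i , l)) ∙ (v (i , j) ⊕ v (i , l)))
                    IsNatural Pℕ (e i) (e j ⊹ e l)
      normˡ i = norm-value (e i) (e j ⊹ e l) (bᵢ i)

    half-unit : ∀ {x} → x + x ≈ ι 2 → x ≈ 1#
    half-unit 2x≈2 = halve (trans 2x≈2 (+-congˡ (+-identityʳ 1#)))

    half-zero : ∀ {x} → x + x ≈ 0# → x ≈ 0#
    half-zero 2x≈0 = halve (trans 2x≈0 (sym (+-identityˡ 0#)))

    v-unit : ∀ c → HasCoefficient c c 2 → v c ∙ v c ≈ 1#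
    v-unit (i , j) h = half-unit (polarised i j i j 2 h)

    v-zero : ∀ c → HasCoefficient c c 0 → ∀ k → v c k ≈ 0#
    v-zero (i , j) h = ∙≈0⇒≈0 (v (i , j)) (half-zero (polarised i j i j 0 h))

    zero-∙ : ∀ c {u : Fin s → Carrier} → HasCoefficient c c 0 → v c ∙ u ≈ 0#
    zero-∙ c h = sum-zero {s} λ k → trans (*-congʳ (v-zero c h k)) (zeroˡ _)

    -- The cross terms of the last two squares of `P` make the inner product of each twin pair equal
    -- to 1, which forces the unit vectors to coincide.
    twin-equal : ∀ {c d} → Twin c d → ∀ k → v c k ≈ v d k
    twin-equal (twin-sym t) k = sym (twin-equal t k)
    twin-equal twin₄₂ = equal-unit-vectors (v (3F , 1F)) (v (4F , 1F))
      (v-unit (3F , 1F) ≡.refl) (v-unit (4F , 1F) ≡.refl)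
      (half-unit (polarised 3F 1F 4F 1F 2 ≡.refl))
    twin-equal twin₂₃ = equal-unit-vectors (v (1F , 2F)) (v (4F , 3F))
      (v-unit (1F , 2F) ≡.refl) (v-unit (4F , 3F) ≡.refl)
      (begin
        v (1F , 2F) ∙ v (4F , 3F)
          ≈⟨ +-identityʳ _ ⟨
        v (1F , 2F) ∙ v (4F , 3F) + 0#
          -- The other diagonal contributes nothing: the square of `x 4F * y 2F` is absent from `P`,
          -- so `v (4F , 2F)` vanishes.
          ≈⟨ +-congˡ (trans (∙-comm (v (1F , 3F)) _) (zero-∙ (4F , 2F) ≡.refl)) ⟨
        v (1F , 2F) ∙ v (4F , 3F) + v (1F , 3F) ∙ v (4F , 2F)
          ≈⟨ polarised 1F 2F 4F 3F 1 ≡.refl ⟩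
        ι 1
          ≈⟨ +-identityʳ 1# ⟩
        1# ∎)

    -- For cells in one row or column the rectangle degenerates, and `polarised` gives twice their
    -- inner product. For a proper rectangle the subderivation removes the opposite diagonal.
    ⊥-sound : ∀ {c d} → c ⊥ d → v c ∙ v d ≈ 0#
    ⊥-sound {c} {d} (⊥-sym d⊥c) = trans (∙-comm (v c) (v d)) (⊥-sound d⊥c)
    ⊥-sound (⊥-zero {c} h) = zero-∙ c h
    ⊥-sound (⊥-row {i} {j} {l} h) =
      half-zero (trans (+-congˡ (∙-comm (v (i , j)) (v (i , l)))) (polarised i j i l 0 h))
    ⊥-sound (⊥-col {i} {j} {k} h) = half-zero (polarised i j k j 0 h)
    ⊥-sound (⊥-rect {i} {j} {k} {l} h r) = begin
      v (i , j) ∙ v (k , l)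
        ≈⟨ +-identityʳ _ ⟨
      v (i , j) ∙ v (k , l) + 0#
        ≈⟨ +-congˡ (⊥-sound r) ⟨
      v (i , j) ∙ v (k , l) + v (i , l) ∙ v (k , j)
        ≈⟨ polarised i j k l 0 h ⟩
      0# ∎
    ⊥-sound (⊥-twin t c′⊥d) = trans (∙-cong {s} (twin-equal t) (λ _ → refl)) (⊥-sound c′⊥d)

    12≤s : 12 ℕ.≤ s
    12≤s = orthonormal⇒≤ (v ∘ cell) orthonormal
      where
      orthonormal : ∀ p q → v (cell p) ∙ v (cell q) ≈ ι (e p q)
      orthonormal p q with p ≟ q
      ... | yes ≡.refl = trans (v-unit (cell p) (cell-unit p))
        (sym (trans (ι-cong (e-diag p)) (+-identityʳ 1#)))
      ... | no p≢q = trans (⊥-sound (cell-⊥ p q p≢q)) (sym (ι-cong (e-off p q p≢q)))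

-- Closure properties of bilinear forms.

module BilinearClosure {c ℓ} (R : CommutativeRing c ℓ) (m n : ℕ) where
  open Forms R m n
  open BiquadraticClosure R m n using (δ; ∑-δ; ∑-merge)
  private
    module R = CommutativeRing R
    module P = CommutativeRing polynomialRing
  open Algebra.Properties.Semiring.Sum P.semiring using (sum-cong-≋)

  bilinear-monomial : ∀ i j → IsBilinearForm (x i * y j)
  bilinear-monomial i j = (λ i′ j′ → δ j j′ R.* δ i i′) , ≋-sym (≋-trans
    (sum-cong-≋ {m} λ i′ → ≋-trans
      (sum-cong-≋ {n} λ j′ → ≋-trans
        (*-cong (≋-trans (*-cong (con-* _ _) ≋-refl) (*-assoc _ _ _)) ≋-refl) (*-assoc _ _ _))
      (≋-trans (∑-δ j λ j′ → con (δ i i′) * x i′ * y j′) (*-assoc _ _ _)))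
    (∑-δ i λ i′ → x i′ * y j))

  bilinear-+ : ∀ {p q} → IsBilinearForm p → IsBilinearForm q → IsBilinearForm (p + q)
  bilinear-+ (a , p≋) (b , q≋) = (λ i j → a i j R.+ b i j) ,
    ≋-trans (+-cong p≋ q≋) (∑-merge {m} λ i → ∑-merge {n} λ j → ≋-sym (≋-trans
      (*-cong (≋-trans (*-cong (con-+ _ _) ≋-refl) (P.distribʳ _ _ _)) ≋-refl) (P.distribʳ _ _ _)))

-- The upper bound: twelve explicit squares.

module UpperBound {c ℓ₁ ℓ₂} (ℝ : RealNumbers c ℓ₁ ℓ₂) where
  open RealNumbers ℝ using (commutativeRing)
  open Forms commutativeRing 5 4
  open BilinearClosure commutativeRing 5 4
  module P = CommutativeRing polynomialRing
  open Algebra.Solver.Ring.NaturalCoefficients.Default P.commutativeSemiring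
    using (solve; _:=_; _:+_; _:*_; _:^_; con)

  forms : Vec Polynomial 12
  forms =
      x 0F * y 0F ∷ x 0F * y 1F ∷ x 0F * y 2F
    ∷ x 1F * y 0F ∷ x 1F * y 3F
    ∷ x 2F * y 1F ∷ x 2F * y 3F
    ∷ x 3F * y 2F ∷ x 3F * y 3F
    ∷ x 4F * y 0F
    ∷ x 1F * y 2F + x 4F * y 3F
    -- Expanded into monomials so that `bilinear-+` applies.
    ∷ x 3F * y 1F + x 4F * y 1F ∷ []

  forms-bilinear : All IsBilinearForm forms
  forms-bilinear =
      bilinear-monomial 0F 0F ∷ bilinear-monomial 0F 1F ∷ bilinear-monomial 0F 2F
    ∷ bilinear-monomial 1F 0F ∷ bilinear-monomial 1F 3F
    ∷ bilinear-monomial 2F 1F ∷ bilinear-monomial 2F 3F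
    ∷ bilinear-monomial 3F 2F ∷ bilinear-monomial 3F 3F
    ∷ bilinear-monomial 4F 0F
    ∷ bilinear-+ (bilinear-monomial 1F 2F) (bilinear-monomial 4F 3F)
    ∷ bilinear-+ (bilinear-monomial 3F 1F) (bilinear-monomial 4F 1F) ∷ []

  sum-of-squares : polynomial (P ℝ) ≋ ∑[ k < 12 ] (lookup forms k ^ 2)
  sum-of-squares = solve 9 (λ x₁ x₂ x₃ x₄ x₅ y₁ y₂ y₃ y₄ →
      x₁ :^ 2 :* y₁ :^ 2 :+ x₁ :^ 2 :* y₂ :^ 2 :+ x₁ :^ 2 :* y₃ :^ 2
      :+ x₂ :^ 2 :* y₁ :^ 2 :+ x₂ :^ 2 :* y₄ :^ 2
      :+ x₃ :^ 2 :* y₂ :^ 2 :+ x₃ :^ 2 :* y₄ :^ 2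
      :+ x₄ :^ 2 :* y₃ :^ 2 :+ x₄ :^ 2 :* y₄ :^ 2
      :+ x₅ :^ 2 :* y₁ :^ 2
      :+ (x₂ :* y₃ :+ x₅ :* y₄) :^ 2
      :+ (x₄ :+ x₅) :^ 2 :* y₂ :^ 2
    -- Mirrors how the sum over `Fin 12` unfolds: nested to the right and ended by 0.
    := (x₁ :* y₁) :^ 2 :+ ((x₁ :* y₂) :^ 2 :+ ((x₁ :* y₃) :^ 2
      :+ ((x₂ :* y₁) :^ 2 :+ ((x₂ :* y₄) :^ 2
      :+ ((x₃ :* y₂) :^ 2 :+ ((x₃ :* y₄) :^ 2
      :+ ((x₄ :* y₃) :^ 2 :+ ((x₄ :* y₄) :^ 2
      :+ ((x₅ :* y₁) :^ 2
      :+ ((x₂ :* y₃ :+ x₅ :* y₄) :^ 2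
      :+ ((x₄ :* y₂ :+ x₅ :* y₂) :^ 2 :+ con 0))))))))))))
    ≋-refl (x 0F) (x 1F) (x 2F) (x 3F) (x 4F) (y 0F) (y 1F) (y 2F) (y 3F)

  isSumOfSquares : IsSumOfSquares 12 (polynomial (P ℝ))
  isSumOfSquares = lookup forms , All.lookup⁺ forms-bilinear , sum-of-squares

theorem2p2 : ∀ {c ℓ₁ ℓ₂} (ℝ : RealNumbers c ℓ₁ ℓ₂) →
    Forms.HasSosRank (RealNumbers.commutativeRing ℝ) 5 4 (P ℝ) 12
theorem2p2 ℝ = UpperBound.isSumOfSquares ℝ ,
  λ s (f , f-bilinear , P≋) → LowerBound.12≤s ℝ f f-bilinear P≋
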